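{- Let $d,k\in\mathbb{N}$. If $X$ is an $\omega^{2d+1}$-large finite set with $\min X > \max\{4,k\}$ and $C$ is a $k$-coloring of an $X$-quasistrong finite binary tree $T$, then there exist an $\omega^d$-large $Y \subseteq X$ and a tree $S \subseteq T$ such that $S$ is both $Y$-quasistrong and $(C,Y)$-prehomogeneous.
   Context: Strings are finite binary sequences; $|\sigma|$ is the length, $\sigma\preceq\tau$ ($\sigma\prec\tau$) means $\sigma$ is an (proper) initial segment of $\tau$, and $\tau$ extends $\sigma$ if $\sigma\preceq\tau$; two strings are incompatible if neither is an initial segment of the other. $2^i$ denotes the set of strings of length $i$. A tree is a set of strings closed under initial segments. A $k$-coloring is a map into $\{0,\dots,k-1\}$. For a finite set $X=\{x_0<\dots<x_n\}\subseteq\mathbb{N}$, a finite binary tree $T$ is $X$-quasistrong if $T\cap 2^{x_i}\ne\emptyset$ for every $i\le n$ and, for each $i<n$, every $\sigma\in T\cap 2^{x_i}$ has exactly two incompatible extensions in $T\cap 2^{x_{i+1}}$. For a coloring $C$ of strings, $T$ is $(C,X)$-prehomogeneous for color $c$ if for every $i<n$, $\sigma\in T\cap 2^{x_i}$ and $\tau\in T\cap 2^{x_{i+1}}$ with $\sigma\prec\tau$ there is $\zeta\in T$ with $\sigma\preceq\zeta\preceq\tau$ and $C(\zeta)=c$; $T$ is $(C,X)$-prehomogeneous if it is so for some color. Largeness: write $X<Y$ if $\max X<\min Y$ (or $X=\emptyset\neq Y$). A stack of size $n$ is a sequence $(X_m:m<n)$ of nonempty finite sets with $X_m<X_{m+1}$.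 A nonempty finite set $X$ is $\omega$-large if $|X|>\min X$ (as usual, $\omega^1$-large means $\omega$-large and $\omega^0$-large means nonempty); $X$ is $\omega^d\cdot n$-large if it is the union of a stack of $n$ many $\omega^d$-large sets; $X$ is $\omega^{d+1}$-large if $X=\{\min X\}\cup X_1$ where $\min X_1>\min X$ and $X_1$ is $\omega^d\cdot\min X$-large. -}

module Defs where

open import Data.Nat using (ℕ; zero; suc; _<_; _⊔_)
open import Data.Bool using (Bool)
open import Data.Fin using (Fin)
open import Data.List using (List; []; _∷_; _++_; length)
open import Data.List.Membership.Propositional using (_∈_)
open import Data.List.Relation.Unary.All using (All)
open import Data.List.Relation.Unary.Linked using (Linked)
open import Data.Product using (Σ; ∃; ∃₂; _×_; _,_)
open import Data.Sum using (_⊎_)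
open import Data.Unit using (⊤)
open import Data.Empty using (⊥)
open import Relation.Binary.PropositionalEquality using (_≡_; _≢_)
open import Relation.Nullary using (¬_)

Str : Set
Str = List Bool

_⪯_ : Str → Str → Set
σ ⪯ τ = ∃ λ ρ → σ ++ ρ ≡ τ

_≺_ : Str → Str → Set
σ ≺ τ = σ ⪯ τ × σ ≢ τ

Incompatible : Str → Str → Set
Incompatible σ τ = ¬ (σ ⪯ τ) × ¬ (τ ⪯ σ)

FinSet : List ℕ → Set
FinSet X = Linked _<_ X

-- min X > m  (X is increasing, so its head is its minimum; vacuous for ∅)
MinAbove : ℕ → List ℕ → Set
MinAbove m [] = ⊤
MinAbove m (x ∷ _) = m < x

-- Largeness.  For increasing lists, a stack (X_0 < ... < X_{n-1}) of
-- nonempty sets with union X is exactly a splitting of X into n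
-- consecutive nonempty blocks.
mutual
  Large : ℕ → List ℕ → Set
  Large zero [] = ⊥
  Large zero (_ ∷ _) = ⊤
  Large (suc d) [] = ⊥
  Large (suc d) (x ∷ xs) = LargeMul d x xs

  LargeMul : ℕ → ℕ → List ℕ → Set
  LargeMul d zero xs = xs ≡ []
  LargeMul d (suc n) xs =
    ∃₂ λ ys zs → xs ≡ ys ++ zs × Large d ys × LargeMul d n zs

IsTree : List Str → Set
IsTree T = ∀ σ τ → τ ∈ T → σ ⪯ τ → σ ∈ T

_⊆T_ : List Str → List Str → Set
S ⊆T T = ∀ σ → σ ∈ S → σ ∈ T

Consecutive : (ℕ → ℕ → Set) → List ℕ → Set
Consecutive P [] = ⊤
Consecutive P (x ∷ []) = ⊤
Consecutive P (x ∷ y ∷ ys) = P x y × Consecutive P (y ∷ ys)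

QuasiStrong : List Str → List ℕ → Set
QuasiStrong T X =
  All (λ x → ∃ λ σ → σ ∈ T × length σ ≡ x) X
  × Consecutive (λ x y → ∀ σ → σ ∈ T → length σ ≡ x →
      ∃₂ λ τ₁ τ₂ →
        (τ₁ ∈ T × length τ₁ ≡ y × σ ⪯ τ₁)
        × (τ₂ ∈ T × length τ₂ ≡ y × σ ⪯ τ₂)
        × Incompatible τ₁ τ₂
        × (∀ τ → τ ∈ T → length τ ≡ y → σ ⪯ τ → τ ≡ τ₁ ⊎ τ ≡ τ₂)) X

PreHomogeneousFor : ∀ {k} → (Str → Fin k) → List Str → List ℕ → Fin k → Set
PreHomogeneousFor C T X c =
  Consecutive (λ x y → ∀ σ τ → σ ∈ T → length σ ≡ x → τ ∈ T → length τ ≡ y →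
      σ ≺ τ → ∃ λ ζ → ζ ∈ T × σ ⪯ ζ × ζ ⪯ τ × C ζ ≡ c) X

PreHomogeneous : ∀ {k} → (Str → Fin k) → List Str → List ℕ → Set
PreHomogeneous {k} C T X = ∃ λ (c : Fin k) → PreHomogeneousFor C T X c

{-# OPTIONS --safe #-}
-- Only the colours of nodes on the levels of X are used, so T becomes a full
-- binary tree with a k-colouring, and the theorem follows by induction on d.
-- To pass from ω^d to ω^(d+1), take a stack of blocks far above the first k
-- levels and solve them for ω^d from the top downwards, each node being coloured
-- by its own colour and by the colours which the higher blocks have above it.
-- All end nodes of one block then have the same future, so that every block has
-- a single colour and the pigeonhole principle yields many blocks of the same
-- colour.  This is done simultaneously above k + 1 nodes of the first k levels,
-- two of which receive the same colour; the level where they branch becomes the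
-- minimum of Y.  The factor ω^2 pays for the iterated exponentials in the number
-- of auxiliary colours.  In the step from 0 to 1 blocks are single levels; a colour is
-- either met densely in a sequence of intervals or avoided by a cone over one of
-- them, whence an induction on the number of colours.

module Submission where

open import Defs
open import Algebra.Properties.CommutativeSemigroup using (x∙yz≈y∙xz)
open import Data.Bool using (Bool; true; false)
open import Data.Empty using (⊥-elim)
open import Data.Fin using (Fin; zero; suc; combine; remQuot; finToFun; funToFin) renaming (_<_ to _<ᶠ_)
open import Data.Fin.Properties using (_≟_; any?; pigeonhole; remQuot-combine; finToFun-funToFin)
open import Data.List using (List; []; _∷_; _++_; length; map; allFin)
open import Data.List.Membership.Propositional using (_∈_)
open import Data.List.Membership.Propositional.Properties using (∈-allFin; ∈-map⁺; ∈-map⁻; ∈-++⁺ˡ; ∈-++⁺ʳ; ∈-++⁻)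
open import Data.List.Properties using (∷-injective; ++-assoc; ++-identityʳ; length-++; length-tabulate)
import Data.List.Relation.Unary.All.Properties as All
open import Data.List.Relation.Unary.All as All using (All; []; _∷_)
open import Data.List.Relation.Unary.Any using (here; there)
open import Data.List.Relation.Unary.Linked using ([]; [-]; _∷_)
open import Data.Nat using (ℕ; zero; suc; pred; _+_; _*_; _^_; _⊔_; _≤_; _<_; z≤n; s≤s)
open import Data.Nat.Properties hiding (_≟_)
open import Data.Nat.Tactic.RingSolver using (solve-∀)
open import Data.Product using (∃; ∃₂; _×_; _,_; proj₁; proj₂)
open import Data.Sum using (_⊎_; inj₁; inj₂)
open import Data.Unit using (⊤; tt)
open import Data.Vec using (Vec; []; _∷_; toList; replicate; lookup; tabulate; head; tail)
open import Data.Vec.Properties using (tabulate-cong; tabulate∘lookup)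
open import Data.Vec.Relation.Unary.All using () renaming (All to AllV; [] to []ᵥ; _∷_ to _∷ᵥ_)
open import Function using (_∘_)
open import Relation.Binary.PropositionalEquality using (_≡_; _≢_; refl; sym; trans; cong; subst; _≗_)
open import Relation.Nullary using (¬_; yes; no)

-- Splitting trees of one colour over the full binary tree

-- A subtree of the full binary tree with levels X, coloured by f, that splits
-- exactly at the levels Y.  Between two consecutive splittings the colour c is
-- met, and every branch ends, after its last splitting, at a node coloured c;
-- these end nodes need not lie on a common level.  The flag says whether c has
-- already been met since the previous splitting.
data Good {K : Set} (c : K) : Bool → (Str → K) → List ℕ → List ℕ → Set where
  leaf : ∀ {b f x X} → f [] ≡ c → Good c b f (x ∷ X) []
  see  : ∀ {b f x X Y} → f [] ≡ c → Good c true f (x ∷ X) Y → Good c b f (x ∷ X) Y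
  skip : ∀ {b f x X Y} β → Good c b (λ ρ → f (β ∷ ρ)) X Y → Good c b f (x ∷ X) Y
  fork : ∀ {f x X Y} → Good c false (λ ρ → f (false ∷ ρ)) X Y →
         Good c false (λ ρ → f (true ∷ ρ)) X Y → Good c true f (x ∷ X) (x ∷ Y)

recolour : ∀ {K K′ : Set} {c : K} {b f X Y} (h : K → K′) {f′ : Str → K′} →
  (∀ ρ → h (f ρ) ≡ f′ ρ) → Good c b f X Y → Good (h c) b f′ X Y
recolour h e (leaf p)   = leaf (trans (sym (e [])) (cong h p))
recolour h e (see p t)  = see (trans (sym (e [])) (cong h p)) (recolour h e t)
recolour h e (skip β t) = skip β (recolour h (e ∘ (β ∷_)) t)
recolour h e (fork l r) = fork (recolour h (e ∘ (false ∷_)) l) (recolour h (e ∘ (true ∷_)) r)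

extend : ∀ {K : Set} {c : K} {b f X Y} X′ → Good c b f X Y → Good c b f (X ++ X′) Y
extend X′ (leaf p)   = leaf p
extend X′ (see p t)  = see p (extend X′ t)
extend X′ (skip β t) = skip β (extend X′ t)
extend X′ (fork l r) = fork (extend X′ l) (extend X′ r)

walk : ∀ {K : Set} {c : K} {b f X Y} V (τ : Vec Bool (length V)) →
  Good c b (λ ρ → f (toList τ ++ ρ)) X Y → Good c b f (V ++ X) Y
walk []      []      t = t
walk (_ ∷ V) (β ∷ τ) t = skip β (walk V τ t)

-- Going left at every fork leaves a single path to an end node of colour `c`; since `leaf` fits
-- either flag, so does the path.
collapse : ∀ {K : Set} {c : K} {b b′ f X Y} → Good c b f X Y → Good c b′ f X []
collapse (leaf p)   = leaf p
collapse (see _ t)  = collapse t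
collapse (skip β t) = skip β (collapse t)
collapse (fork l _) = skip false (collapse l)

-- End nodes of a block may lie below its top level; prolonging them to the left assigns to each a
-- node at which a future is defined.
pad : ∀ n → Str → Vec Bool n
pad zero    _       = []
pad (suc n) []      = false ∷ pad n []
pad (suc n) (β ∷ ρ) = β ∷ pad n ρ

module _ {K : Set} {M : ℕ} {X′ Z : List ℕ} {u : Vec K M} where

  -- All end nodes of the lower tree have the same future u, so each of them can
  -- be prolonged by one of the given trees.
  graft : ∀ {V f b Y} {a : K} {v : Vec Bool (length V) → Vec K M} →
    Good (a ∷ u) b (λ ρ → f ρ ∷ v (pad (length V) ρ)) V Y →
    (∀ τ → v τ ≡ u → Good a true (λ ρ → f (toList τ ++ ρ)) X′ Z) →
    Good a b f (V ++ X′) (Y ++ Z)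
  graft {V = V} (leaf p)   s = see (cong head p) (walk V (pad _ []) (s _ (cong tail p)))
  graft         (see p t)  s = see (cong head p) (graft t s)
  graft         (skip β t) s = skip β (graft t (s ∘ (β ∷_)))
  graft         (fork l r) s = fork (graft l (s ∘ (false ∷_))) (graft r (s ∘ (true ∷_)))

  -- For a block that is merely crossed: only the future `u` of its end node matters, and its colour
  -- `a` may differ from `c`, so the flag `b` is passed on unchanged.
  through : ∀ {V f b b′} {a c : K} {v : Vec Bool (length V) → Vec K M} →
    Good (a ∷ u) b′ (λ ρ → f ρ ∷ v (pad (length V) ρ)) V [] →
    (∀ τ → v τ ≡ u → Good c b (λ ρ → f (toList τ ++ ρ)) X′ Z) →
    Good c b f (V ++ X′) Z
  through {V = V} (leaf p)   s = walk V (pad _ []) (s _ (cong tail p))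
  through         (see p t)  s = through t s
  through         (skip β t) s = skip β (through t (s ∘ (β ∷_)))

Solver : ℕ → ℕ → List ℕ → Set
Solver d n X = (f : Str → Fin n) → ∃₂ λ c Y → Large d Y × Good c true f X Y

-- The flag `false` demands that `c` be met before the first splitting, so that the tree can stand
-- above a further splitting.
MulSolver : ℕ → ℕ → ℕ → List ℕ → Set
MulSolver d N n X = (f : Str → Fin n) → ∃₂ λ c Z → LargeMul d N Z × Good c false f X Z

MulSolver-++ : ∀ {d N n X} V → MulSolver d N n X → MulSolver d N n (V ++ X)
MulSolver-++ V s f with s (λ ρ → f (toList (replicate (length V) false) ++ ρ))
... | c , Z , lZ , t = c , Z , lZ , walk V _ t

-- Families of colours as single colours

record Coder (I : Set) (n m : ℕ) : Set where
  field
    enc     : (I → Fin n) → Fin m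
    dec     : Fin m → I → Fin n
    dec-enc : ∀ g → dec (enc g) ≗ g

open Coder

⊤-coder : ∀ {n} → Coder ⊤ n n
⊤-coder .enc g       = g tt
⊤-coder .dec c _     = c
⊤-coder .dec-enc _ _ = refl

Fin-coder : ∀ {m n} → Coder (Fin m) n (n ^ m)
Fin-coder .enc     = funToFin
Fin-coder .dec     = finToFun
Fin-coder .dec-enc = finToFun-funToFin

-- This is n^(2^e), the number of `n`-colourings of the strings of length `e`; squaring mirrors the
-- division of strings by their first bit.
squares : ℕ → ℕ → ℕ
squares n zero    = n
squares n (suc e) = squares n e * squares n e

×Vec-coder : ∀ {I n e} ℓ → Coder I n (squares n e) →
  Coder (I × Vec Bool ℓ) n (squares n (ℓ + e))
×Vec-coder zero    C .enc g              = C .enc (λ i → g (i , []))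
×Vec-coder zero    C .dec c (i , [])     = C .dec c i
×Vec-coder zero    C .dec-enc g (i , []) = C .dec-enc _ i
×Vec-coder (suc ℓ) C .enc g =
  combine (×Vec-coder ℓ C .enc (λ (i , τ) → g (i , false ∷ τ)))
          (×Vec-coder ℓ C .enc (λ (i , τ) → g (i , true ∷ τ)))
×Vec-coder {n = n} {e} (suc ℓ) C .dec c (i , false ∷ τ) =
  ×Vec-coder ℓ C .dec (proj₁ (remQuot {squares n (ℓ + e)} (squares n (ℓ + e)) c)) (i , τ)
×Vec-coder {n = n} {e} (suc ℓ) C .dec c (i , true ∷ τ) =
  ×Vec-coder ℓ C .dec (proj₂ (remQuot {squares n (ℓ + e)} (squares n (ℓ + e)) c)) (i , τ)
×Vec-coder {e = e} (suc ℓ) C .dec-enc g (i , false ∷ τ) = trans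
  (cong (λ p → ×Vec-coder {e = e} ℓ C .dec (proj₁ p) (i , τ))
    (remQuot-combine (×Vec-coder {e = e} ℓ C .enc (λ (i , τ) → g (i , false ∷ τ))) _))
  (×Vec-coder {e = e} ℓ C .dec-enc (λ (i , τ) → g (i , false ∷ τ)) (i , τ))
×Vec-coder {e = e} (suc ℓ) C .dec-enc g (i , true ∷ τ) = trans
  (cong (λ p → ×Vec-coder {e = e} ℓ C .dec (proj₂ p) (i , τ))
    (remQuot-combine (×Vec-coder {e = e} ℓ C .enc (λ (i , τ) → g (i , false ∷ τ))) _))
  (×Vec-coder {e = e} ℓ C .dec-enc (λ (i , τ) → g (i , true ∷ τ)) (i , τ))

encVec : ∀ {k M} → Vec (Fin k) M → Fin (k ^ M)
encVec = funToFin ∘ lookup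

decVec : ∀ {k M} → Fin (k ^ M) → Vec (Fin k) M
decVec = tabulate ∘ finToFun

decVec-encVec : ∀ {k M} (v : Vec (Fin k) M) → decVec (encVec v) ≡ v
decVec-encVec v = trans (tabulate-cong (finToFun-funToFin (lookup v))) (tabulate∘lookup v)

-- Stacks of blocks

-- `S` is a spacer, crossed along one path, and `V` a block. `e` counts the levels of the blocks
-- below, so `V` is solved for `2 ^ e` nodes at once, each contributing `suc M` colours: its own and
-- those of the `M` higher blocks.
Stack : (d k e M : ℕ) → List ℕ → Set
Stack d k e zero    X = ⊤
Stack d k e (suc M) X = ∃₂ λ S V → ∃ λ X′ → X ≡ S ++ V ++ X′ ×
  Solver d (squares (k ^ suc M) e) V × Stack d k (length V + e) M X′

-- A plan for the blocks from the bottom upwards: end the branches in a block of colour `c`, cross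
-- it to meet `c`, adopt its splittings, or cross a block of any colour. The flag is that of `Good`.
data Selection {k : ℕ} (c : Fin k) :
    Bool → ∀ {M} → Vec (Fin k) M → Vec (List ℕ) M → List ℕ → Set where
  stop : ∀ {b M} {v : Vec _ M} {Y Ys} → Selection c b (c ∷ v) (Y ∷ Ys) []
  see  : ∀ {b M} {v : Vec _ M} {Y Ys Z} → Selection c true v Ys Z → Selection c b (c ∷ v) (Y ∷ Ys) Z
  take : ∀ {M} {v : Vec _ M} {Y Ys Z} → Selection c true v Ys Z →
         Selection c true (c ∷ v) (Y ∷ Ys) (Y ++ Z)
  drop : ∀ {b M a} {v : Vec _ M} {Y Ys Z} → Selection c b v Ys Z → Selection c b (a ∷ v) (Y ∷ Ys) Z

-- The blocks are treated from the top downwards: a node of a block is coloured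
-- by its own colour together with the colours that all higher blocks have above
-- its leftmost extension.
stackColours : ∀ {d k e I X} M → Stack d k e M X → (∀ n → Coder I n (squares n e)) →
  (g : I → Str → Fin k) → ∃ λ (Ys : Vec (List ℕ) M) → AllV (Large d) Ys ×
  (∀ i → ∃ λ v → ∀ {c b Z} → Selection c b v Ys Z → Good c b (g i) X Z)
stackColours zero    _                           C g = [] , []ᵥ , λ i → [] , λ ()
stackColours {k = k} {I = I} (suc M) (S , V , X′ , refl , solve , st) C g =
  Y ∷ Ys , lY ∷ᵥ lYs , λ i → v i , λ s → walk S zeros (select i (v i) (block i) s)
  where
  zeros = replicate (length S) false
  g⁺ : I → Str → Fin k
  g⁺ i ρ = g i (toList zeros ++ ρ)
  -- Every node at the top of `V` becomes an index of its own, so that the higher blocks are thinned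
  -- in the same way above all of them.
  above = stackColours M st (λ n → ×Vec-coder (length V) (C n)) (λ (i , τ) ρ → g⁺ i (toList τ ++ ρ))
  Ys = proj₁ above
  lYs = proj₁ (proj₂ above)
  future : I → Vec Bool (length V) → Vec (Fin k) M
  future i τ = proj₁ (proj₂ (proj₂ above) (i , τ))
  h : I → Str → Vec (Fin k) (suc M)
  h i ρ = g⁺ i ρ ∷ future i (pad (length V) ρ)
  -- Packing the colourings of all indices into one makes `Y` common to them.
  solved = solve (λ ρ → C _ .enc (λ i → encVec (h i ρ)))
  Y = proj₁ (proj₂ solved)
  lY = proj₁ (proj₂ (proj₂ solved))
  v : I → Vec (Fin k) (suc M)
  v i = decVec (C _ .dec (proj₁ solved) i)
  block : ∀ i → Good (v i) true (h i) V Y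
  block i = recolour (λ c → decVec (C _ .dec c i))
    (λ ρ → trans (cong decVec (C _ .dec-enc _ i)) (decVec-encVec (h i ρ))) (proj₂ (proj₂ (proj₂ solved)))
  select : ∀ i w {c b Z} → Good w true (h i) V Y →
    Selection c b w (Y ∷ Ys) Z → Good c b (g⁺ i) (V ++ X′) Z
  select i w t stop     = extend X′ (recolour head (λ _ → refl) (collapse t))
  select i w t (see s)  = graft (collapse t) λ { τ refl → proj₂ (proj₂ (proj₂ above) (i , τ)) s }
  select i w t (take s) = graft t λ { τ refl → proj₂ (proj₂ (proj₂ above) (i , τ)) s }
  select i w t (drop s) = through (collapse {b′ = true} t) λ { τ refl → proj₂ (proj₂ (proj₂ above) (i , τ)) s }

-- Pigeonhole principle for the colours of the blocks

occurrences : ∀ {k M} → Fin k → Vec (Fin k) M → ℕ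
occurrences c []      = 0
occurrences c (a ∷ v) with c ≟ a
... | yes _ = suc (occurrences c v)
... | no _  = occurrences c v

total : ∀ {k} → (Fin k → ℕ) → ℕ
total {zero}  g = 0
total {suc k} g = g zero + total (g ∘ suc)

total-mono : ∀ {k} {g g′ : Fin k → ℕ} → (∀ c → g c ≤ g′ c) → total g ≤ total g′
total-mono {zero}  le = z≤n
total-mono {suc k} le = +-mono-≤ (le zero) (total-mono (le ∘ suc))

total-mono-< : ∀ {k} {g g′ : Fin k → ℕ} a → g a < g′ a → (∀ c → g c ≤ g′ c) → total g < total g′
total-mono-< zero    lt le = +-mono-≤ lt (total-mono (le ∘ suc))
total-mono-< {g = g} {g′} (suc a) lt le = ≤-trans (≤-reflexive (sym (+-suc (g zero) _)))
  (+-mono-≤ (le zero) (total-mono-< a lt (le ∘ suc)))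

total-bound : ∀ {k q} {g : Fin k → ℕ} → (∀ c → g c ≤ q) → total g ≤ k * q
total-bound {zero}  le = z≤n
total-bound {suc k} le = +-mono-≤ (le zero) (total-bound (le ∘ suc))

length≤total-occurrences : ∀ {k M} (v : Vec (Fin k) M) → M ≤ total (λ c → occurrences c v)
length≤total-occurrences []      = z≤n
length≤total-occurrences (a ∷ v) = ≤-trans (s≤s (length≤total-occurrences v)) (total-mono-< a more monotone)
  where
  more : occurrences a v < occurrences a (a ∷ v)
  more with a ≟ a
  ... | yes _  = ≤-refl
  ... | no a≢a = ⊥-elim (a≢a refl)
  monotone : ∀ c → occurrences c v ≤ occurrences c (a ∷ v)
  monotone c with c ≟ a
  ... | yes _ = n≤1+n _
  ... | no _  = ≤-refl

frequent : ∀ {k M} q (v : Vec (Fin k) M) → k * q < M → ∃ λ c → q < occurrences c v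
frequent q v lt with any? (λ c → q <? occurrences c v)
... | yes found = found
... | no none   = ⊥-elim (<⇒≱ lt (≤-trans (length≤total-occurrences v)
  (total-bound (λ c → ≮⇒≥ (λ q< → none (c , q<))))))

-- One occurrence beyond the `n` blocks taken is spent on `stop`, which meets `c` after the last
-- splitting.
gather : ∀ {d k M} n (c : Fin k) {v : Vec _ M} {Ys} → AllV (Large d) Ys → n < occurrences c v →
  ∃ λ Z → LargeMul d n Z × Selection c true v Ys Z
gather n c {a ∷ v} (lY ∷ᵥ lYs) lt with c ≟ a
gather zero    c (lY ∷ᵥ lYs) lt       | yes refl = [] , refl , stop
gather (suc n) c (lY ∷ᵥ lYs) (s≤s lt) | yes refl with gather n c lYs lt
... | Z , lZ , s = _ , (_ , _ , refl , lY , lZ) , take s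
gather n       c (lY ∷ᵥ lYs) lt       | no _ with gather n c lYs lt
... | Z , lZ , s = Z , lZ , drop s

-- A second spare occurrence, the lowest one, is spent on `see`, which meets `c` before the first
-- splitting.
gather-seen : ∀ {d k M} n (c : Fin k) {v : Vec _ M} {Ys} → AllV (Large d) Ys →
  suc n < occurrences c v → ∃ λ Z → LargeMul d n Z × Selection c false v Ys Z
gather-seen n c {a ∷ v} (lY ∷ᵥ lYs) lt with c ≟ a
gather-seen n c (lY ∷ᵥ lYs) (s≤s lt) | yes refl with gather n c lYs lt
... | Z , lZ , s = Z , lZ , see s
gather-seen n c (lY ∷ᵥ lYs) lt       | no _ with gather-seen n c lYs lt
... | Z , lZ , s = Z , lZ , drop s

-- Among `suc (k * suc N)` blocks some colour occurs at least `N + 2` times: `N` blocks to take and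
-- the two spare ones.
stack-MulSolver : ∀ {d k N X} → Stack d k 0 (suc (k * suc N)) X → MulSolver d N k X
stack-MulSolver {N = N} st f with stackColours _ st (λ _ → ⊤-coder) (λ _ → f)
... | Ys , lYs , colours with colours tt
... | v , select with frequent (suc N) v ≤-refl
... | c , lt with gather-seen N c lYs lt
... | Z , lZ , s = c , Z , lZ , select s


-- Singleton blocks

Everywhere : ∀ {K : Set} → (K → Set) → (Str → K) → List ℕ → Set
Everywhere P f []      = ⊤
Everywhere P f (_ ∷ X) = P (f []) × Everywhere P (λ ρ → f (false ∷ ρ)) X × Everywhere P (λ ρ → f (true ∷ ρ)) X

module _ {K : Set} {P : K → Set} where

  everywhere : (∀ a → P a) → ∀ f X → Everywhere P f X
  everywhere p f []      = tt
  everywhere p f (_ ∷ X) = p _ , everywhere p _ X , everywhere p _ X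

  Everywhere-prefix : ∀ f W {X} → Everywhere P f (W ++ X) → Everywhere P f W
  Everywhere-prefix f []      _           = tt
  Everywhere-prefix f (_ ∷ W) (p , l , r) = p , Everywhere-prefix _ W l , Everywhere-prefix _ W r

  Everywhere-suffix : ∀ f W {X} → Everywhere P f (W ++ X) →
    ∀ (τ : Vec Bool (length W)) → Everywhere P (λ ρ → f (toList τ ++ ρ)) X
  Everywhere-suffix f []      e           []          = e
  Everywhere-suffix f (_ ∷ W) (_ , l , _) (false ∷ τ) = Everywhere-suffix _ W l τ
  Everywhere-suffix f (_ ∷ W) (_ , _ , r) (true ∷ τ)  = Everywhere-suffix _ W r τ

Everywhere-avoid : ∀ {K : Set} {c : K} {cs} f X →
  Everywhere (_∈ c ∷ cs) f X → Everywhere (_≢ c) f X → Everywhere (_∈ cs) f X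
Everywhere-avoid f []      _                _             = tt
Everywhere-avoid f (_ ∷ X) (here eq , _ , _) (ne , _ , _)  = ⊥-elim (ne eq)
Everywhere-avoid f (_ ∷ X) (there p , l , r) (_ , l′ , r′) =
  p , Everywhere-avoid _ X l l′ , Everywhere-avoid _ X r r′

search : ∀ {n} (c : Fin n) f W → Good c false f W [] ⊎ Everywhere (_≢ c) f W
search c f []      = inj₂ tt
search c f (_ ∷ W) with f [] ≟ c
... | yes eq = inj₁ (leaf eq)
... | no ne with search c (λ ρ → f (false ∷ ρ)) W
... | inj₁ t = inj₁ (skip false t)
... | inj₂ l with search c (λ ρ → f (true ∷ ρ)) W
... | inj₁ t = inj₁ (skip true t)
... | inj₂ r = inj₂ (ne , l , r)

⊎-∀Vec : ∀ n {A : Set} {B : Vec Bool n → Set} → (∀ τ → A ⊎ B τ) → A ⊎ (∀ τ → B τ)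
⊎-∀Vec zero    h with h []
... | inj₁ a = inj₁ a
... | inj₂ b = inj₂ λ { [] → b }
⊎-∀Vec (suc n) h with ⊎-∀Vec n (h ∘ (false ∷_)) | ⊎-∀Vec n (h ∘ (true ∷_))
... | inj₁ a | _      = inj₁ a
... | inj₂ _ | inj₁ a = inj₁ a
... | inj₂ l | inj₂ r = inj₂ λ { (false ∷ τ) → l τ ; (true ∷ τ) → r τ }

splitLength : ∀ {A : Set} n (X : List A) → n ≤ length X → ∃₂ λ W R → X ≡ W ++ R × length W ≡ n
splitLength zero    X       le       = [] , X , refl , refl
splitLength (suc n) (x ∷ X) (s≤s le) with splitLength n X le
... | W , R , refl , refl = x ∷ W , R , refl , refl

module _ {n N : ℕ} where

  Win : (Str → Fin n) → List ℕ → Set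
  Win f X = ∃₂ λ c Z → LargeMul 0 N Z × Good c false f X Z

  -- Either c occurs in every block above every node, and then all blocks start
  -- with a level of the tree, or some cone avoids c throughout a block.
  dense-or-win : ∀ {γ c cs} →
    (∀ X → γ ≤ length X → ∀ f → Everywhere (_∈ cs) f X → Win f X) →
    ∀ j X → suc j * suc γ ≤ suc (length X) →
    ∃ λ Z → LargeMul 0 j Z × (∀ f → Everywhere (_∈ c ∷ cs) f X → Win f X ⊎ Good c false f X Z)
  dense-or-win {γ} {c} {cs} avoiding zero X le = [] , refl , go
    where
    go : ∀ f → Everywhere (_∈ c ∷ cs) f X → Win f X ⊎ Good c false f X []
    go f ev with search c f X
    ... | inj₁ t = inj₂ t
    ... | inj₂ a = inj₁ (avoiding X (≤-pred (≤-trans (m≤m+n _ 0) le)) f (Everywhere-avoid f X ev a))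
  -- Each interval `W` of `γ` levels is followed by a splitting level `z`, except the last interval;
  -- hence the `suc` on the right of the bound.
  dense-or-win {γ} {c} {cs} avoiding (suc j) X le
    with splitLength γ X (≤-pred (≤-trans (m≤m+n (suc γ) _) le))
  ... | W , R , refl , refl
    with R | +-cancelˡ-≤ (suc γ) _ _ (≤-trans le (≤-reflexive (cong suc (length-++ W))))
  ... | z ∷ X′ | le′ with dense-or-win {γ} {c} {cs} avoiding j X′ le′
  ... | Z , lZ , rec = z ∷ Z , (z ∷ [] , Z , refl , tt , lZ) , go
    where
    go : ∀ f → Everywhere (_∈ c ∷ cs) f (W ++ z ∷ X′) →
         Win f (W ++ z ∷ X′) ⊎ Good c false f (W ++ z ∷ X′) (z ∷ Z)
    above : ∀ f → Everywhere (_∈ c ∷ cs) f (W ++ z ∷ X′) → ∀ τ →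
      Win f (W ++ z ∷ X′) ⊎ Good c true (λ ρ → f (toList τ ++ ρ)) (z ∷ X′) (z ∷ Z)
    above f ev τ with Everywhere-suffix f W ev τ
    ... | _ , l , r with rec _ l | rec _ r
    ... | inj₁ (c′ , Z′ , lZ′ , t) | _ = inj₁ (c′ , Z′ , lZ′ , walk W τ (skip false t))
    ... | inj₂ _ | inj₁ (c′ , Z′ , lZ′ , t) = inj₁ (c′ , Z′ , lZ′ , walk W τ (skip true t))
    ... | inj₂ t | inj₂ t′ = inj₂ (fork t t′)
    go f ev with search c f W
    ... | inj₂ a with avoiding W ≤-refl f (Everywhere-avoid f W (Everywhere-prefix f W ev) a)
    ... | c′ , Z′ , lZ′ , t = inj₁ (c′ , Z′ , lZ′ , extend (z ∷ X′) t)
    go f ev | inj₁ t with ⊎-∀Vec (length W) (above f ev)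
    ... | inj₁ w = inj₁ w
    -- With the empty vector of futures all end nodes have the same future, and a tree is at hand
    -- above every `τ`.
    ... | inj₂ s = inj₂ (graft {v = λ _ → []} (recolour (_∷ []) (λ _ → refl) t) (λ τ _ → s τ))

  -- Each colour costs a factor `suc N`, for the `N + 1` intervals around `N` splittings. With no
  -- colour left a single level is contradictory, and the factor 2 guarantees that level.
  homogeneous : ∀ cs X → 2 * suc N ^ length cs ≤ suc (length X) →
    ∀ f → Everywhere (_∈ cs) f X → Win f X
  homogeneous []       []      (s≤s ()) f ev
  homogeneous []       (_ ∷ X) le       f (() , _)
  homogeneous (c ∷ cs) X       le       f ev = conclude (dense-or-win avoiding N X bound)
    where
    instance
      positive = m*n≢0 2 (suc N ^ length cs) {{_}} {{m^n≢0 (suc N) (length cs)}}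
    γ = pred (2 * suc N ^ length cs)
    γ+1 : suc γ ≡ 2 * suc N ^ length cs
    γ+1 = suc-pred (2 * suc N ^ length cs)
    avoiding : ∀ X → γ ≤ length X → ∀ f → Everywhere (_∈ cs) f X → Win f X
    avoiding X le = homogeneous cs X (subst (_≤ suc (length X)) γ+1 (s≤s le))
    bound : suc N * suc γ ≤ suc (length X)
    bound = ≤-trans (≤-reflexive (trans (cong (suc N *_) γ+1) (x∙yz≈y∙xz *-commutativeSemigroup (suc N) 2 (suc N ^ length cs)))) le
    conclude : _ → Win f X
    conclude (Z , lZ , t) with t f ev
    ... | inj₁ w = w
    ... | inj₂ t = c , Z , lZ , t

singleton-MulSolver : ∀ {n N X} → 2 * suc N ^ n ≤ suc (length X) → MulSolver 0 N n X
singleton-MulSolver {n} {N} {X} le f = homogeneous (allFin n) X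
  (≤-trans (≤-reflexive (cong (λ k → 2 * suc N ^ k) (length-tabulate {n = n} (λ i → i)))) le)
  f (everywhere ∈-allFin f X)

-- The lowest level

-- The node with index `i < n` consists of `i` times `false`, one `true` and then `false`
-- throughout; the last node has no `true`.
comb : ∀ n → Fin (suc n) → Vec Bool n
comb zero    _       = []
comb (suc n) zero    = true ∷ replicate n false
comb (suc n) (suc i) = false ∷ comb n i

-- For `i < j` the two nodes part exactly at the level with index `i`. The trees above them have the
-- same splittings `Z`, hence join to one tree there.
fork-comb : ∀ {K : Set} R {f : Str → K} {X Z} {e : Fin (suc (length R)) → K} →
  (∀ i → Good (e i) false (λ ρ → f (toList (comb (length R) i) ++ ρ)) X Z) →
  ∀ i j → i <ᶠ j → e i ≡ e j → ∃₂ λ r c → r ∈ R × Good c true f (R ++ X) (r ∷ Z)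
fork-comb []      t zero    zero    () _
fork-comb []      t (suc ())
fork-comb (r ∷ R) t zero    (suc j) lt eq = r , _ , here refl ,
  fork (walk R _ (subst (λ c → Good c false _ _ _) (sym eq) (t (suc j)))) (walk R _ (t zero))
fork-comb (r ∷ R) {f} t (suc i) (suc j) (s≤s lt) eq
  with fork-comb R {λ ρ → f (false ∷ ρ)} (t ∘ suc) i j lt eq
... | r′ , c , r′∈R , t′ = r′ , c , there r′∈R , skip false t′


-- Large sets

Ascending : ℕ → List ℕ → Set
Ascending m []      = ⊤
Ascending m (x ∷ X) = m ≤ x × Ascending (suc x) X

-- max X + 1, or m if X is empty.
top : ℕ → List ℕ → ℕ
top m []      = m
top m (x ∷ X) = top (suc x) X

Ascending-weaken : ∀ {m m′} X → m ≤ m′ → Ascending m′ X → Ascending m X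
Ascending-weaken []      le _       = tt
Ascending-weaken (x ∷ X) le (p , a) = ≤-trans le p , a

Ascending-++⁻ : ∀ {m} X {Y} → Ascending m (X ++ Y) → Ascending m X × Ascending (top m X) Y
Ascending-++⁻ []      a       = tt , a
Ascending-++⁻ (x ∷ X) (p , a) with Ascending-++⁻ X a
... | aX , aY = (p , aX) , aY

Ascending⇒≥ : ∀ {m} X → Ascending m X → All (m ≤_) X
Ascending⇒≥ []      _       = []
Ascending⇒≥ (x ∷ X) (p , a) = p ∷ Ascending⇒≥ X (Ascending-weaken X (≤-trans p (n≤1+n x)) a)

FinSet⇒Ascending : ∀ {x X} → FinSet (x ∷ X) → Ascending (suc x) X
FinSet⇒Ascending [-]     = tt
FinSet⇒Ascending (p ∷ l) = p , FinSet⇒Ascending l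

Ascending⇒FinSet : ∀ {m} X → Ascending m X → FinSet X
Ascending⇒FinSet []          _           = []
Ascending⇒FinSet (x ∷ [])    _           = [-]
Ascending⇒FinSet (x ∷ y ∷ X) (_ , p , a) = p ∷ Ascending⇒FinSet (y ∷ X) (p , a)

Good-Ascending : ∀ {K : Set} {c : K} {b f X Y m} → Good c b f X Y → Ascending m X → Ascending m Y
Good-Ascending (leaf _)   _       = tt
Good-Ascending (see _ t)  a       = Good-Ascending t a
Good-Ascending (skip _ t) (p , a) = Ascending-weaken _ (≤-trans p (n≤1+n _)) (Good-Ascending t a)
Good-Ascending (fork l _) (p , a) = p , Good-Ascending l a

Good-⊆ : ∀ {K : Set} {c : K} {b f X Y} → Good c b f X Y → All (_∈ X) Y
Good-⊆ (leaf _)   = []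
Good-⊆ (see _ t)  = Good-⊆ t
Good-⊆ (skip _ t) = All.map there (Good-⊆ t)
Good-⊆ (fork l _) = here refl ∷ All.map there (Good-⊆ l)

length+≤top : ∀ {m} X → Ascending m X → length X + m ≤ top m X
length+≤top []      _       = ≤-refl
length+≤top {m} (x ∷ X) (p , a) =
  ≤-trans (≤-reflexive (sym (+-suc (length X) m))) (≤-trans (+-monoʳ-≤ (length X) (s≤s p)) (length+≤top X a))

≤top : ∀ {m} X → Ascending m X → m ≤ top m X
≤top X a = ≤-trans (m≤n+m _ (length X)) (length+≤top X a)

Ascending⇒<top : ∀ {m} X → Ascending m X → All (_< top m X) X
Ascending⇒<top []      _       = []
Ascending⇒<top (x ∷ X) (p , a) = ≤top X a ∷ Ascending⇒<top X a

Large-nonempty : ∀ d X → Large d X → 1 ≤ length X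
Large-nonempty zero    (_ ∷ _) _ = s≤s z≤n
Large-nonempty (suc d) (_ ∷ _) _ = s≤s z≤n

LargeMul-length : ∀ d n X → LargeMul d n X → n ≤ length X
LargeMul-length d zero    X _ = z≤n
LargeMul-length d (suc n) _ (Y , Z , refl , lY , lZ) =
  ≤-trans (+-mono-≤ (Large-nonempty d Y lY) (LargeMul-length d n Z lZ)) (≤-reflexive (sym (length-++ Y)))

Large-length : ∀ d {m} X → Large (suc d) X → Ascending m X → m ≤ length X
Large-length d (x ∷ X) lX (p , _) = ≤-trans p (≤-trans (LargeMul-length d x X lX) (n≤1+n _))

LargeMul-split : ∀ {d} n m X → LargeMul d (n + m) X →
  ∃₂ λ Y Z → X ≡ Y ++ Z × LargeMul d n Y × LargeMul d m Z
LargeMul-split zero    m X lX = [] , X , refl , refl , lX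
LargeMul-split (suc n) m _ (V , _ , refl , lV , lX) with LargeMul-split n m _ lX
... | Y , Z , refl , lY , lZ = V ++ Y , Z , sym (++-assoc V Y Z) , (V , Y , refl , lV , lY) , lZ

mutual
  -- New elements are absorbed by the last block. Positivity guarantees that there is one: a minimum
  -- 0 would ask for an empty stack.
  Large-++ : ∀ d X {Z} → All (1 ≤_) X → Large d X → Large d (X ++ Z)
  Large-++ zero    (_ ∷ _)     _       _  = tt
  Large-++ (suc d) (suc x ∷ X) (_ ∷ p) lX = LargeMul-++ d x X p lX

  LargeMul-++ : ∀ d n X {Z} → All (1 ≤_) X → LargeMul d (suc n) X → LargeMul d (suc n) (X ++ Z)
  LargeMul-++ d zero    _ {Z} p (Y , _ , refl , lY , refl) =
    Y ++ Z , [] , trans (cong (_++ Z) (++-identityʳ Y)) (sym (++-identityʳ (Y ++ Z))) ,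
    Large-++ d Y (All.++⁻ˡ Y p) lY , refl
  LargeMul-++ d (suc n) _ {Z} p (Y , W , refl , lY , lW) =
    Y , W ++ Z , ++-assoc Y W Z , lY , LargeMul-++ d n W (All.++⁻ʳ Y p) lW

LargeMul-≤ : ∀ {d n m} X → All (1 ≤_) X → 1 ≤ n → n ≤ m → LargeMul d m X → LargeMul d n X
LargeMul-≤ {d} {suc n} X p _ n≤m lX with m≤n⇒∃[o]m+o≡n n≤m
... | o , refl with LargeMul-split (suc n) o X lX
... | Y , Z , refl , lY , _ = LargeMul-++ d n Y (All.++⁻ˡ Y p) lY

-- Two of the n + 1 nodes of a comb over R receive the same colour; R ∪ Z is then
-- entered at their branching point r, and r ≤ N blocks of Z suffice above it.
fork-Solver : ∀ {d n N} R X → length R ≡ n → Ascending 1 (R ++ X) → All (_≤ N) R →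
  MulSolver d N (n ^ suc n) X → Solver (suc d) n (R ++ X)
fork-Solver {d} {n} R X refl a bound solve f
  -- A single colouring records the colours above all nodes of the comb, so that they share `Z`.
  with solve (λ ρ → Fin-coder .enc (λ i → f (toList (comb n i) ++ ρ)))
... | code , Z , lZ , t with pigeonhole (n<1+n n) (Fin-coder .dec code)
... | i , j , i<j , eq
  with fork-comb R (λ i → recolour (λ c → Fin-coder .dec c i) (λ ρ → Fin-coder .dec-enc (λ i → f (toList (comb n i) ++ ρ)) i) t) i j i<j eq
... | r , c , r∈R , t′ with Good-Ascending t′ a
... | 1≤r , aZ = c , r ∷ Z , LargeMul-≤ Z
  (All.map (≤-trans (s≤s z≤n)) (Ascending⇒≥ Z aZ)) 1≤r (All.lookup bound r∈R) lZ , t′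

-- Growth

n<2^n : ∀ n → n < 2 ^ n
n<2^n zero    = s≤s z≤n
n<2^n (suc n) = +-mono-≤ (≤-trans (s≤s z≤n) (n<2^n n)) (≤-trans (n<2^n n) (m≤m+n _ 0))

2^-mono : ∀ {m n} → m ≤ n → 2 ^ m ≤ 2 ^ n
2^-mono = ^-monoʳ-≤ 2

tower : ℕ → ℕ → ℕ
tower zero    m = m
tower (suc j) m = tower j (2 ^ m)

tower-mono : ∀ j {m n} → m ≤ n → tower j m ≤ tower j n
tower-mono zero    le = le
tower-mono (suc j) le = tower-mono j (2^-mono le)

top-++ : ∀ m X {Y} → top m (X ++ Y) ≡ top (top m X) Y
top-++ m []      = refl
top-++ m (x ∷ X) = top-++ (suc x) X

Large-doubles : ∀ d {m} X → Large (suc d) X → Ascending m X → m + m ≤ top m X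
Large-doubles d {m} X lX a = ≤-trans (+-monoˡ-≤ m (Large-length d X lX a)) (length+≤top X a)

LargeMul-doubles : ∀ d n {m} X → LargeMul (suc d) n X → Ascending m X → 2 ^ n * m ≤ top m X
LargeMul-doubles d zero {m} X lX a = ≤-trans (≤-reflexive (*-identityˡ m)) (≤top X a)
LargeMul-doubles d (suc n) {m} _ (Y , Z , refl , lY , lZ) a with Ascending-++⁻ Y a
... | aY , aZ = begin
  2 * 2 ^ n * m       ≡⟨ cong (_* m) (*-comm 2 (2 ^ n)) ⟩
  2 ^ n * 2 * m       ≡⟨ *-assoc (2 ^ n) 2 m ⟩
  2 ^ n * (2 * m)     ≡⟨ cong (λ k → 2 ^ n * (m + k)) (+-identityʳ m) ⟩
  2 ^ n * (m + m)     ≤⟨ *-monoʳ-≤ (2 ^ n) (Large-doubles d Y lY aY) ⟩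
  2 ^ n * top m Y     ≤⟨ LargeMul-doubles d n Z lZ aZ ⟩
  top (top m Y) Z     ≡⟨ top-++ m Y ⟨
  top m (Y ++ Z)      ∎
  where open ≤-Reasoning

-- The minimum `x` provides `x` blocks, each of which at least doubles the bound.
Large-exponentiates : ∀ d {m} X → Large (suc (suc d)) X → Ascending m X → 2 ^ m ≤ top m X
Large-exponentiates d (x ∷ X) lX (p , a) = ≤-trans (2^-mono p)
  (≤-trans (m≤m*n (2 ^ x) (suc x)) (LargeMul-doubles d x X lX a))

LargeMul-tower : ∀ d j {m} X → LargeMul (suc (suc d)) j X → Ascending m X → tower j m ≤ top m X
LargeMul-tower d zero    X lX a = ≤top X a
LargeMul-tower d (suc j) {m} _ (Y , Z , refl , lY , lZ) a with Ascending-++⁻ Y a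
... | aY , aZ = ≤-trans (tower-mono j (Large-exponentiates d Y lY aY))
  (≤-trans (LargeMul-tower d j Z lZ aZ) (≤-reflexive (sym (top-++ m Y))))

Large-tower : ∀ d {m} X → 3 ≤ m → Large (suc (suc (suc d))) X → Ascending m X → tower 3 m ≤ top m X
Large-tower d (x ∷ X) 3≤m lX (p , a) with m≤n⇒∃[o]m+o≡n (≤-trans 3≤m p)
... | o , refl with LargeMul-split 3 o X lX
... | Y , Z , refl , lY , _ with Ascending-++⁻ Y a
... | aY , aZ = ≤-trans (tower-mono 3 (≤-trans p (n≤1+n x))) (≤-trans (LargeMul-tower d 3 Y lY aY)
  (≤-trans (≤top Z aZ) (≤-reflexive (sym (top-++ (suc x) Y)))))

-- The inequality fails at 4 and starts at 5 with 31 ≤ 32, which is one use of the hypothesis min X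
-- > 4.
quadratic≤2^ : ∀ {m} → 5 ≤ m → 1 + m + m * m ≤ 2 ^ m
quadratic≤2^ le with m≤n⇒∃[o]m+o≡n le
... | o , refl = go o
  where
  step : ∀ k → 2 * (1 + (5 + k) + (5 + k) * (5 + k)) ≡
               (1 + (6 + k) + (6 + k) * (6 + k)) + (19 + 9 * k + k * k)
  step = solve-∀
  go : ∀ k → 1 + (5 + k) + (5 + k) * (5 + k) ≤ 2 ^ (5 + k)
  go zero    = n≤1+n 31
  go (suc k) = ≤-trans (≤-trans (m≤m+n _ _) (≤-reflexive (sym (step k)))) (*-monoʳ-≤ 2 (go k))

^-mono-2^ : ∀ {n a} j → n ≤ 2 ^ a → n ^ j ≤ 2 ^ (a * j)
^-mono-2^ {n} {a} j le = ≤-trans (^-monoˡ-≤ j le) (≤-reflexive (^-*-assoc 2 a j))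

squares-bound : ∀ {n a} e → n ≤ 2 ^ a → squares n e ≤ 2 ^ (a * 2 ^ e)
squares-bound {n} {a} zero le = ≤-trans le (≤-reflexive (cong (2 ^_) (sym (*-identityʳ a))))
squares-bound {n} {a} (suc e) le = begin
  squares n e * squares n e              ≤⟨ *-mono-≤ (squares-bound {a = a} e le) (squares-bound {a = a} e le) ⟩
  2 ^ (a * 2 ^ e) * 2 ^ (a * 2 ^ e)      ≡⟨ ^-distribˡ-+-* 2 (a * 2 ^ e) (a * 2 ^ e) ⟨
  2 ^ (a * 2 ^ e + a * 2 ^ e)            ≡⟨ cong (2 ^_) (double a (2 ^ e)) ⟩
  2 ^ (a * 2 ^ suc e)                    ∎
  where
  open ≤-Reasoning
  double : ∀ a p → a * p + a * p ≡ a * (2 * p)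
  double = solve-∀

-- The number of colours for which a block of a stack must be solved stays below the triple
-- exponential that one spacer supplies.
stackColours-bound : ∀ {m n e M} → 5 ≤ m → n ≤ m → e ≤ m → M ≤ m → squares (n ^ M) e < tower 3 m
stackColours-bound {m} {n} {e} {M} 5≤m n≤m e≤m M≤m = begin-strict
  squares (n ^ M) e         ≤⟨ squares-bound {a = m * M} e (^-mono-2^ {a = m} M (≤-trans n≤m (<⇒≤ (n<2^n m)))) ⟩
  2 ^ (m * M * 2 ^ e)       ≤⟨ 2^-mono (*-mono-≤ (≤-trans (*-monoʳ-≤ m M≤m) m*m≤) (2^-mono e≤m)) ⟩
  2 ^ (2 ^ m * 2 ^ m)       ≡⟨ cong (2 ^_) (^-distribˡ-+-* 2 m m) ⟨
  2 ^ (2 ^ (m + m))         <⟨ ^-monoʳ-< 2 ≤-refl (^-monoʳ-< 2 ≤-refl m+m<) ⟩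
  2 ^ (2 ^ (2 ^ m))         ∎
  where
  open ≤-Reasoning
  m*m≤ : m * m ≤ 2 ^ m
  m*m≤ = ≤-trans (m≤n+m (m * m) (1 + m)) (quadratic≤2^ 5≤m)
  m+m< : m + m < 2 ^ m
  m+m< = ≤-trans (s≤s (+-monoʳ-≤ m (≤-trans (≤-reflexive (sym (*-identityˡ m)))
    (*-monoˡ-≤ m (≤-trans (s≤s z≤n) 5≤m))))) (quadratic≤2^ 5≤m)

module _ {w n : ℕ} (5≤w : 5 ≤ w) (n<w : n < w) where

  open ≤-Reasoning

  private
    w+w*w<2^w : w + w * w < 2 ^ w
    w+w*w<2^w = quadratic≤2^ 5≤w

  combColours≤ : n ^ suc n ≤ 2 ^ (w * w)
  combColours≤ = ≤-trans (^-mono-2^ {a = w} (suc n) (≤-trans (<⇒≤ n<w) (<⇒≤ (n<2^n w))))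
    (2^-mono (*-monoʳ-≤ w n<w))

  combColours*≤ : suc w * n ^ suc n ≤ 2 ^ (w + w * w)
  combColours*≤ = ≤-trans (*-mono-≤ (n<2^n w) combColours≤) (≤-reflexive (sym (^-distribˡ-+-* 2 w (w * w))))

  -- The number of levels asked for by `singleton-MulSolver` for `w` splittings and the `n ^ suc n`
  -- joint colours of the comb.
  singletons-bound : 2 * suc w ^ (n ^ suc n) ≤ tower 3 w
  singletons-bound = begin
    2 * suc w ^ (n ^ suc n)       ≤⟨ *-monoʳ-≤ 2 (^-mono-2^ {a = w} (n ^ suc n) (n<2^n w)) ⟩
    2 ^ suc (w * n ^ suc n)       ≤⟨ 2^-mono exponent ⟩
    tower 3 w                     ∎
    where
    exponent : suc (w * n ^ suc n) ≤ 2 ^ (2 ^ w)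
    exponent = begin
      suc (w * n ^ suc n)            ≤⟨ s≤s (*-monoʳ-≤ w combColours≤) ⟩
      1 + w * 2 ^ (w * w)            ≤⟨ +-monoˡ-≤ (w * 2 ^ (w * w)) (m^n>0 2 (w * w)) ⟩
      suc w * 2 ^ (w * w)            ≤⟨ *-monoˡ-≤ (2 ^ (w * w)) (n<2^n w) ⟩
      2 ^ w * 2 ^ (w * w)            ≡⟨ ^-distribˡ-+-* 2 w (w * w) ⟨
      2 ^ (w + w * w)                ≤⟨ 2^-mono (<⇒≤ w+w*w<2^w) ⟩
      2 ^ (2 ^ w)                    ∎

  -- The factor 2 is there because every block of the stack comes with a spacer.
  blocks-bound : suc (n ^ suc n * suc w) * 2 ≤ tower 3 w
  blocks-bound = begin
    suc (n ^ suc n * suc w) * 2      ≡⟨ *-comm _ 2 ⟩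
    2 * suc (n ^ suc n * suc w)      ≡⟨ cong (λ k → 2 * suc k) (*-comm (n ^ suc n) (suc w)) ⟩
    2 * suc (suc w * n ^ suc n)      ≤⟨ *-monoʳ-≤ 2 (≤-trans (s≤s combColours*≤) (n<2^n _)) ⟩
    2 ^ suc (2 ^ (w + w * w))        ≤⟨ 2^-mono (^-monoʳ-< 2 ≤-refl w+w*w<2^w) ⟩
    tower 3 w                        ∎

  stackLength-bound : suc (n ^ suc n * suc w) ≤ tower 3 w
  stackLength-bound = ≤-trans (m≤m*n (suc (n ^ suc n * suc w)) 2) blocks-bound

  combColours-bound : n ^ suc n ≤ tower 3 w
  combColours-bound = ≤-trans (≤-trans (m≤m*n (n ^ suc n) (suc w)) (n≤1+n _)) stackLength-bound

-- Solvers for large sets, by induction on the exponent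

-- The large sets serve alternately as spacer `S` and block `V`: the spacer lifts the minimum of `V`
-- above the number of colours, so that the induction hypothesis `solve` applies to `V`.
buildStack : ∀ {d n} →
  (∀ n X m → 5 ≤ m → n < m → Ascending m X → Large (suc (suc d * 2)) X → Solver (suc d) n X) →
  ∀ M e m Y X → 5 ≤ m → n ≤ m → e ≤ m → M ≤ m → Ascending m (Y ++ X) →
  LargeMul (suc (suc d * 2)) (M * 2) Y → Stack (suc d) n e M (Y ++ X)
buildStack solve zero e m Y X _ _ _ _ _ _ = tt
buildStack {d} {n} solve (suc M) e m _ X 5≤m n≤m e≤m M<m a (S , _ , refl , lS , V , Y , refl , lV , lY)
  with Ascending-++⁻ S (subst (Ascending m) (++-assoc S (V ++ Y) X) a)
... | aS , aVYX with Ascending-++⁻ V (subst (Ascending (top m S)) (++-assoc V Y X) aVYX)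
... | aV , aYX = S , V , Y ++ X , trans (++-assoc S (V ++ Y) X) (cong (S ++_) (++-assoc V Y X)) ,
  solve _ V (top m S) (≤-trans 5≤m m≤S)
    (≤-trans (stackColours-bound 5≤m n≤m e≤m M<m) (Large-tower (d * 2) S (≤-trans (s≤s (s≤s (s≤s z≤n))) 5≤m) lS aS))
    aV lV ,
  buildStack solve M (length V + e) (top (top m S) V) Y X (≤-trans 5≤m m≤V) (≤-trans n≤m m≤V)
    (≤-trans (+-monoʳ-≤ (length V) (≤-trans e≤m m≤S)) (length+≤top V aV))
    (≤-trans (<⇒≤ M<m) m≤V) aYX lY
  where
  m≤S = ≤top S aS
  m≤V = ≤-trans m≤S (≤top V aV)

-- Of the five blocks available, the first provides the comb, the next three the
-- room for a triple exponential, and the last one the stack.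
large-Solver : ∀ d n X m → 5 ≤ m → n < m → Ascending m X → Large (suc (suc d * 2)) X → Solver (suc d) n X
large-Solver d n (x ∷ _) m 5≤m n<m (m≤x , a) lX with m≤n⇒∃[o]m+o≡n (≤-trans 5≤m m≤x)
large-Solver d n (x ∷ _) m 5≤m n<m (m≤x , a) (B , _ , refl , lB , lX) | o , refl
  with LargeMul-split 3 (1 + o) _ lX
... | T , _ , refl , lT , b ∷ Y , X , refl , lY , _
  with Ascending-++⁻ B a
... | aB , aTYX with Ascending-++⁻ T aTYX
... | aT , T≤b , aYX
  with splitLength n (x ∷ B) (≤-trans (<⇒≤ n<m) (≤-trans m≤x
         (≤-trans (n≤1+n x) (≤-trans (Large-length _ B lB aB) (n≤1+n _)))))
... | R , J , x∷B≡R++J , lenR = subst (Solver (suc d) n) (sym X≡)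
  (fork-Solver R (J ++ rest) lenR (Ascending-weaken _ (≤-trans (s≤s z≤n) 5≤m) (subst (Ascending m) X≡ (m≤x , a)))
    (All.++⁻ˡ R (subst (All (_≤ w)) x∷B≡R++J (All.map <⇒≤ (Ascending⇒<top {m} (x ∷ B) (m≤x , aB)))))
    (MulSolver-++ J (MulSolver-++ T (MulSolver-++ (b ∷ []) (blocks d lY)))))
  where
  -- `w` exceeds all levels of `x ∷ B`, hence the branching level of the comb, so `w` blocks suffice
  -- above it.
  w = top (suc x) B
  rest = T ++ b ∷ Y ++ X
  X≡ : x ∷ B ++ rest ≡ R ++ J ++ rest
  X≡ = trans (cong (_++ rest) x∷B≡R++J) (++-assoc R J rest)
  5≤w : 5 ≤ w
  5≤w = ≤-trans 5≤m (≤top {m} (x ∷ B) (m≤x , aB))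
  n<w : n < w
  n<w = ≤-trans n<m (≤top {m} (x ∷ B) (m≤x , aB))
  tower≤b : tower 3 w ≤ b
  tower≤b = ≤-trans (LargeMul-tower _ 3 T lT aT) T≤b
  -- `Y` is made of `b` sets that are ω^(2d+1)-large. For d = 0 it is enough that they supply `b`
  -- levels; otherwise they become the spacers and blocks of a stack.
  blocks : ∀ d → LargeMul (suc (d * 2)) b Y → MulSolver d w (n ^ suc n) (Y ++ X)
  blocks zero lY = singleton-MulSolver (≤-trans (singletons-bound 5≤w n<w) (≤-trans tower≤b
    (≤-trans (LargeMul-length _ b Y lY) (≤-trans (m≤m+n _ _)
      (≤-trans (≤-reflexive (sym (length-++ Y))) (n≤1+n _))))))
  blocks (suc d) lY with m≤n⇒∃[o]m+o≡n (≤-trans (blocks-bound 5≤w n<w) tower≤b)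
  ... | o , b≡ with LargeMul-split (suc (n ^ suc n * suc w) * 2) o Y (subst (λ k → LargeMul _ k Y) (sym b≡) lY)
  ... | Y₁ , Y₂ , refl , lY₁ , _ = subst (MulSolver (suc d) w _) (sym (++-assoc Y₁ Y₂ X)) (stack-MulSolver
    (buildStack (large-Solver d) _ 0 (suc b) Y₁ (Y₂ ++ X) (≤-trans 5≤w (≤-trans w≤b (n≤1+n b)))
      (≤-trans (≤-trans (combColours-bound 5≤w n<w) tower≤b) (n≤1+n b)) z≤n
      (≤-trans (≤-trans (stackLength-bound 5≤w n<w) tower≤b) (n≤1+n b))
      (subst (Ascending (suc b)) (++-assoc Y₁ Y₂ X) aYX) lY₁))
    where
    w≤b : w ≤ b
    w≤b = ≤-trans (≤-trans (<⇒≤ (n<2^n w)) (≤-trans (<⇒≤ (n<2^n (2 ^ w))) (<⇒≤ (n<2^n (2 ^ (2 ^ w)))))) tower≤b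

-- Subtrees of T

⪯-refl : ∀ {σ} → σ ⪯ σ
⪯-refl = [] , ++-identityʳ _

⪯-trans : ∀ {σ τ υ} → σ ⪯ τ → τ ⪯ υ → σ ⪯ υ
⪯-trans {σ} (ρ , refl) (ρ′ , refl) = ρ ++ ρ′ , sym (++-assoc σ ρ ρ′)

⪯-length : ∀ {σ τ} → σ ⪯ τ → length σ ≤ length τ
⪯-length {σ} (ρ , refl) = ≤-trans (m≤m+n _ _) (≤-reflexive (sym (length-++ σ)))

⪯-length-≡ : ∀ {σ τ} → σ ⪯ τ → length σ ≡ length τ → σ ≡ τ
⪯-length-≡ {[]}    ([] , refl) _ = refl
⪯-length-≡ {_ ∷ σ} (ρ , refl)  l = cong (_ ∷_) (⪯-length-≡ (ρ , refl) (suc-injective l))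

⪯-linear : ∀ {σ τ υ} → σ ⪯ υ → τ ⪯ υ → length σ ≤ length τ → σ ⪯ τ
⪯-linear {[]}            _          _           _        = _ , refl
⪯-linear {β ∷ σ} {_ ∷ τ} (ρ , refl) (ρ′ , eq) (s≤s le) with ∷-injective eq
... | refl , eq′ with ⪯-linear (ρ , refl) (ρ′ , eq′) le
... | ρ″ , refl = ρ″ , refl

⪯-comparable : ∀ {σ τ υ} → σ ⪯ υ → τ ⪯ υ → σ ⪯ τ ⊎ τ ⪯ σ
⪯-comparable {σ} {τ} p q with ≤-total (length σ) (length τ)
... | inj₁ le = inj₁ (⪯-linear p q le)
... | inj₂ le = inj₂ (⪯-linear q p le)

Incompatible-⪯ : ∀ {σ τ σ′ τ′} → Incompatible σ τ → σ ⪯ σ′ → τ ⪯ τ′ → Incompatible σ′ τ′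
Incompatible-⪯ {σ} {τ} (¬p , ¬q) s t = apart ∘ (λ r → ⪯-comparable (⪯-trans s r) t) ,
                                       apart ∘ (λ r → ⪯-comparable s (⪯-trans t r))
  where
  apart : ¬ (σ ⪯ τ ⊎ τ ⪯ σ)
  apart (inj₁ p) = ¬p p
  apart (inj₂ q) = ¬q q

prefixes : Str → List Str
prefixes []      = [] ∷ []
prefixes (β ∷ σ) = [] ∷ map (β ∷_) (prefixes σ)

∈-prefixes⁺ : ∀ {σ τ} → σ ⪯ τ → σ ∈ prefixes τ
∈-prefixes⁺ {[]}    {[]}    _          = here refl
∈-prefixes⁺ {[]}    {_ ∷ _} _          = here refl
∈-prefixes⁺ {_ ∷ σ}         (ρ , refl) = there (∈-map⁺ _ (∈-prefixes⁺ (ρ , refl)))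

∈-prefixes⁻ : ∀ {σ} τ → σ ∈ prefixes τ → σ ⪯ τ
∈-prefixes⁻ []      (here refl) = ⪯-refl
∈-prefixes⁻ (_ ∷ τ) (here refl) = _ , refl
∈-prefixes⁻ (β ∷ τ) (there m) with ∈-map⁻ (β ∷_) m
... | _ , m′ , refl with ∈-prefixes⁻ τ m′
... | ρ , refl = ρ , refl

Splits : List Str → ℕ → ℕ → Set
Splits T x y = ∀ σ → σ ∈ T → length σ ≡ x →
  ∃₂ λ τ₁ τ₂ →
    (τ₁ ∈ T × length τ₁ ≡ y × σ ⪯ τ₁)
    × (τ₂ ∈ T × length τ₂ ≡ y × σ ⪯ τ₂)
    × Incompatible τ₁ τ₂
    × (∀ τ → τ ∈ T → length τ ≡ y → σ ⪯ τ → τ ≡ τ₁ ⊎ τ ≡ τ₂)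

Consecutive-map : ∀ {P Q : ℕ → ℕ → Set} → (∀ {x y} → P x y → Q x y) → ∀ Y → Consecutive P Y → Consecutive Q Y
Consecutive-map h []          _       = tt
Consecutive-map h (_ ∷ [])    _       = tt
Consecutive-map h (_ ∷ y ∷ Y) (p , c) = h p , Consecutive-map h (y ∷ Y) c

Consecutive-zip : ∀ {P Q R : ℕ → ℕ → Set} {z} → (∀ {x y} → z ≤ x → P x y → Q x y → R x y) →
  ∀ Y → All (z ≤_) Y → Consecutive P Y → Consecutive Q Y → Consecutive R Y
Consecutive-zip h []          _        _       _        = tt
Consecutive-zip h (_ ∷ [])    _        _       _        = tt
Consecutive-zip h (_ ∷ y ∷ Y) (le ∷ a) (p , c) (q , c′) = h le p q , Consecutive-zip h (y ∷ Y) a c c′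

Apart : ℕ → List Str → List Str → Set
Apart z S S′ = ∀ {σ τ} → σ ∈ S → τ ∈ S′ → z ≤ length σ → ¬ (σ ⪯ τ)

-- From level `z` on no node of one part is extended by a node of the other, so the extensions of
-- `σ` are those in its own part.
Splits-++ : ∀ {S S′ z x y} → Apart z S S′ → Apart z S′ S → z ≤ x →
  Splits S x y → Splits S′ x y → Splits (S ++ S′) x y
Splits-++ {S} {S′} apart apart′ z≤x s s′ σ m refl with ∈-++⁻ S m
... | inj₁ m₁ with s σ m₁ refl
... | τ₁ , τ₂ , (i₁ , e₁) , (i₂ , e₂) , inc , only =
  τ₁ , τ₂ , (∈-++⁺ˡ i₁ , e₁) , (∈-++⁺ˡ i₂ , e₂) , inc , only′
  where
  only′ : ∀ τ → τ ∈ S ++ S′ → _ → σ ⪯ τ → τ ≡ τ₁ ⊎ τ ≡ τ₂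
  only′ τ i e p with ∈-++⁻ S i
  ... | inj₁ i₁ = only τ i₁ e p
  ... | inj₂ i₂ = ⊥-elim (apart m₁ i₂ z≤x p)
Splits-++ {S} {S′} apart apart′ z≤x s s′ σ m refl | inj₂ m₂ with s′ σ m₂ refl
... | τ₁ , τ₂ , (i₁ , e₁) , (i₂ , e₂) , inc , only =
  τ₁ , τ₂ , (∈-++⁺ʳ S i₁ , e₁) , (∈-++⁺ʳ S i₂ , e₂) , inc , only′
  where
  only′ : ∀ τ → τ ∈ S ++ S′ → _ → σ ⪯ τ → τ ≡ τ₁ ⊎ τ ≡ τ₂
  only′ τ i e p with ∈-++⁻ S i
  ... | inj₁ i₁ = ⊥-elim (apart′ m₂ i₁ z≤x p)
  ... | inj₂ i₂ = only τ i₂ e p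

-- Transfer from the full binary tree to `T`

module _ {k : ℕ} (T : List Str) (tree : IsTree T) (C : Str → Fin k) where

  -- The colouring `C` pulled back along the embedding that sends the bits to the two extensions on
  -- the next level.
  colours : ∀ x xs → Consecutive (Splits T) (x ∷ xs) → ∀ σ → σ ∈ T → length σ ≡ x → Str → Fin k
  colours x xs       br       σ m l []          = C σ
  -- A default value for strings that run past the last level.
  colours x []       br       σ m l (_ ∷ ρ)     = C σ
  colours x (y ∷ ys) (s , br) σ m l (false ∷ ρ) =
    let τ , _ , (mτ , lτ , _) , _ = s σ m l in colours y ys br τ mτ lτ ρ
  colours x (y ∷ ys) (s , br) σ m l (true ∷ ρ)  =
    let _ , τ , _ , (mτ , lτ , _) , _ = s σ m l in colours y ys br τ mτ lτ ρ

  module _ (c : Fin k) where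

    Hit : Str → Str → Set
    Hit σ τ = ∃ λ ζ → σ ⪯ ζ × ζ ⪯ τ × C ζ ≡ c

    Hits : List Str → ℕ → ℕ → Set
    Hits S x y = ∀ σ τ → σ ∈ S → length σ ≡ x → τ ∈ S → length τ ≡ y →
      σ ≺ τ → ∃ λ ζ → ζ ∈ S × σ ⪯ ζ × ζ ⪯ τ × C ζ ≡ c

    Hits-++ : ∀ {S S′ z x y} → Apart z S S′ → Apart z S′ S → z ≤ x →
      Hits S x y → Hits S′ x y → Hits (S ++ S′) x y
    Hits-++ {S} apart apart′ z≤x h h′ σ τ m refl i e p with ∈-++⁻ S m | ∈-++⁻ S i
    ... | inj₁ m₁ | inj₂ i₂ = ⊥-elim (apart m₁ i₂ z≤x (proj₁ p))
    ... | inj₂ m₂ | inj₁ i₁ = ⊥-elim (apart′ m₂ i₁ z≤x (proj₁ p))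
    ... | inj₁ m₁ | inj₁ i₁ with h σ τ m₁ refl i₁ e p
    ... | ζ , j , rest = ζ , ∈-++⁺ˡ j , rest
    Hits-++ {S} apart apart′ z≤x h h′ σ τ m refl i e p | inj₂ m₂ | inj₂ i₂ with h′ σ τ m₂ refl i₂ e p
    ... | ζ , j , rest = ζ , ∈-++⁺ʳ S j , rest

    data Subtree : Str → List ℕ → Set where
      tip  : ∀ {ρ y} → ρ ∈ T → length ρ ≡ y → Subtree ρ (y ∷ [])
      fork : ∀ {ρ ρ₁ ρ₂ y z Y} → length ρ ≡ y → Incompatible ρ₁ ρ₂ → Hit ρ ρ₁ → Hit ρ ρ₂ →
             Subtree ρ₁ (z ∷ Y) → Subtree ρ₂ (z ∷ Y) → Subtree ρ (y ∷ z ∷ Y)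

    hit-⪯ : ∀ {σ τ} → Hit σ τ → σ ⪯ τ
    hit-⪯ (_ , p , q , _) = ⪯-trans p q

    hit-below : ∀ {σ σ′ τ} → σ ⪯ σ′ → Hit σ′ τ → Hit σ τ
    hit-below p (ζ , q , r , e) = ζ , ⪯-trans p q , r , e

    -- Unless the flag says that `c` was already met, it is met between `σ` and the root `ρ`. Both
    -- branches of a fork have flag `false`, which gives the two hits demanded there.
    subtree : ∀ {b x xs br σ m l y Y} → Good c b (colours x xs br σ m l) (x ∷ xs) (y ∷ Y) →
      ∃ λ ρ → σ ⪯ ρ × (b ≡ true ⊎ Hit σ ρ) × Subtree ρ (y ∷ Y)
    subtree {σ = σ} (see eq t) with subtree t
    ... | ρ , p , _ , s = ρ , p , inj₂ (σ , ⪯-refl , p , eq) , s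
    subtree {xs = _ ∷ _} {br = s , _} {σ} {m} {l} (skip false t) with s σ m l | subtree t
    ... | _ , _ , (_ , _ , q) , _ | ρ , p , inj₁ e , u = ρ , ⪯-trans q p , inj₁ e , u
    ... | _ , _ , (_ , _ , q) , _ | ρ , p , inj₂ h , u = ρ , ⪯-trans q p , inj₂ (hit-below q h) , u
    subtree {xs = _ ∷ _} {br = s , _} {σ} {m} {l} (skip true t) with s σ m l | subtree t
    ... | _ , _ , _ , (_ , _ , q) , _ | ρ , p , inj₁ e , u = ρ , ⪯-trans q p , inj₁ e , u
    ... | _ , _ , _ , (_ , _ , q) , _ | ρ , p , inj₂ h , u = ρ , ⪯-trans q p , inj₂ (hit-below q h) , u
    -- The greatest level of `Y` carries the tips, so the tree is cut off at the last splitting.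
    subtree {σ = σ} {m} {l} {Y = []} (fork _ _) = σ , ⪯-refl , inj₁ refl , tip m l
    subtree {xs = _ ∷ _} {br = s , _} {σ} {m} {l} {Y = _ ∷ _} (fork t t′)
      with s σ m l | subtree t | subtree t′
    ... | _ , _ , (_ , _ , q) , (_ , _ , q′) , inc , _ | ρ , p , inj₂ h , u | ρ′ , p′ , inj₂ h′ , u′ =
      σ , ⪯-refl , inj₁ refl , fork l (Incompatible-⪯ inc p p′) (hit-below q h) (hit-below q′ h′) u u′

    -- Taking all initial segments of the tips yields a tree that also contains the nodes `ζ` of
    -- colour `c` between the levels.
    nodes : ∀ {ρ Y} → Subtree ρ Y → List Str
    nodes (tip {ρ} _ _)       = prefixes ρ
    nodes (fork _ _ _ _ s s′) = nodes s ++ nodes s′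

    nodes-tree : ∀ {ρ Y} (s : Subtree ρ Y) → IsTree (nodes s)
    nodes-tree (tip _ _)           σ τ m p = ∈-prefixes⁺ (⪯-trans p (∈-prefixes⁻ _ m))
    nodes-tree (fork _ _ _ _ s s′) σ τ m p with ∈-++⁻ (nodes s) m
    ... | inj₁ i = ∈-++⁺ˡ (nodes-tree s σ τ i p)
    ... | inj₂ i = ∈-++⁺ʳ (nodes s) (nodes-tree s′ σ τ i p)

    nodes-⊆T : ∀ {ρ Y} (s : Subtree ρ Y) → nodes s ⊆T T
    nodes-⊆T (tip {ρ} i _)       σ m = tree σ ρ i (∈-prefixes⁻ ρ m)
    nodes-⊆T (fork _ _ _ _ s s′) σ m with ∈-++⁻ (nodes s) m
    ... | inj₁ i = nodes-⊆T s σ i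
    ... | inj₂ i = nodes-⊆T s′ σ i

    root-length : ∀ {ρ y Y} → Subtree ρ (y ∷ Y) → length ρ ≡ y
    root-length (tip _ l)          = l
    root-length (fork l _ _ _ _ _) = l

    root∈nodes : ∀ {ρ Y} (s : Subtree ρ Y) → ρ ∈ nodes s
    root∈nodes (tip _ _)          = ∈-prefixes⁺ ⪯-refl
    root∈nodes (fork _ _ h _ s _) = ∈-++⁺ˡ (nodes-tree s _ _ (root∈nodes s) (hit-⪯ h))

    comparable-below : ∀ {σ τ ζ} → Hit σ τ → ζ ⪯ τ ⊎ τ ⪯ ζ → ζ ⪯ σ ⊎ σ ⪯ ζ
    comparable-below h (inj₁ p) = ⪯-comparable p (hit-⪯ h)
    comparable-below h (inj₂ p) = inj₂ (⪯-trans (hit-⪯ h) p)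

    root-comparable : ∀ {ρ Y ζ} (s : Subtree ρ Y) → ζ ∈ nodes s → ζ ⪯ ρ ⊎ ρ ⪯ ζ
    root-comparable (tip _ _) m = inj₁ (∈-prefixes⁻ _ m)
    root-comparable (fork _ _ h₁ h₂ s₁ s₂) m with ∈-++⁻ (nodes s₁) m
    ... | inj₁ i = comparable-below h₁ (root-comparable s₁ i)
    ... | inj₂ i = comparable-below h₂ (root-comparable s₂ i)

    root-⪯ : ∀ {ρ y Y ζ} (s : Subtree ρ (y ∷ Y)) → ζ ∈ nodes s → y ≤ length ζ → ρ ⪯ ζ
    root-⪯ s m le with root-comparable s m
    ... | inj₂ p = p
    ... | inj₁ p with ⪯-length-≡ p (≤-antisym (⪯-length p) (≤-trans (≤-reflexive (root-length s)) le))
    ... | refl = ⪯-refl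

    root-unique : ∀ {ρ y Y ζ} (s : Subtree ρ (y ∷ Y)) → ζ ∈ nodes s → length ζ ≡ y → ζ ≡ ρ
    root-unique s m l = sym (⪯-length-≡ (root-⪯ s m (≤-reflexive (sym l))) (trans (root-length s) (sym l)))

    nodes-apart : ∀ {ρ ρ′ y Y Y′} (s : Subtree ρ (y ∷ Y)) (s′ : Subtree ρ′ (y ∷ Y′)) →
      Incompatible ρ ρ′ → Apart y (nodes s) (nodes s′)
    nodes-apart s s′ inc m m′ le p = proj₁
      (Incompatible-⪯ inc (root-⪯ s m le) (root-⪯ s′ m′ (≤-trans le (⪯-length p)))) p

    nodes-levels : ∀ {ρ Y} (s : Subtree ρ Y) → All (λ y → ∃ λ σ → σ ∈ nodes s × length σ ≡ y) Y
    nodes-levels s@(tip _ l)             = (_ , root∈nodes s , l) ∷ []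
    nodes-levels s@(fork l _ _ _ s₁ _) = (_ , root∈nodes s , l) ∷
      All.map (λ (σ , m , e) → σ , ∈-++⁺ˡ m , e) (nodes-levels s₁)

    nodes-steps : ∀ {ρ Y} (s : Subtree ρ Y) → FinSet Y →
      Consecutive (λ x y → Splits (nodes s) x y × Hits (nodes s) x y) Y
    nodes-steps (tip _ _) _ = tt
    nodes-steps s@(fork {ρ} {ρ₁} {ρ₂} {y} {z} {Y} l inc h₁ h₂ s₁ s₂) fin@(_ ∷ fin′) =
      (splits , hits) ,
      -- The steps from `z` upwards take place within one of two parts that are apart from level `z`
      -- on.
      Consecutive-zip (λ le (p , q) (p′ , q′) → Splits-++ apart apart′ le p p′ , Hits-++ apart apart′ le q q′)
        (z ∷ Y) (Ascending⇒≥ (z ∷ Y) (≤-refl , FinSet⇒Ascending fin′)) (nodes-steps s₁ fin′) (nodes-steps s₂ fin′)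
      where
      apart = nodes-apart s₁ s₂ inc
      apart′ = nodes-apart s₂ s₁ (proj₂ inc , proj₁ inc)
      ρ₁∈ : ρ₁ ∈ nodes s
      ρ₁∈ = ∈-++⁺ˡ (root∈nodes s₁)
      ρ₂∈ : ρ₂ ∈ nodes s
      ρ₂∈ = ∈-++⁺ʳ (nodes s₁) (root∈nodes s₂)
      next : ∀ τ → τ ∈ nodes s → length τ ≡ z → τ ≡ ρ₁ ⊎ τ ≡ ρ₂
      next τ m e with ∈-++⁻ (nodes s₁) m
      ... | inj₁ i = inj₁ (root-unique s₁ i e)
      ... | inj₂ i = inj₂ (root-unique s₂ i e)
      splits : Splits (nodes s) y z
      splits σ m e with root-unique s m e
      ... | refl = ρ₁ , ρ₂ , (ρ₁∈ , root-length s₁ , hit-⪯ h₁) , (ρ₂∈ , root-length s₂ , hit-⪯ h₂) ,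
        inc , λ τ m e _ → next τ m e
      hits : Hits (nodes s) y z
      hits σ τ m e m′ e′ _ with root-unique s m e | next τ m′ e′
      ... | refl | inj₁ refl = let ζ , p , q , eq = h₁ in ζ , nodes-tree s ζ ρ₁ ρ₁∈ q , p , q , eq
      ... | refl | inj₂ refl = let ζ , p , q , eq = h₂ in ζ , nodes-tree s ζ ρ₂ ρ₂∈ q , p , q , eq

theorem2p3 : (d k : ℕ) (X : List ℕ) → FinSet X → Large (2 * d + 1) X →
    MinAbove (4 ⊔ k) X →
    (T : List Str) → IsTree T → QuasiStrong T X → (C : Str → Fin k) →
    ∃₂ λ (Y : List ℕ) (S : List Str) →
    FinSet Y × All (_∈ X) Y × Large d Y
    × IsTree S × S ⊆T T × QuasiStrong S Y × PreHomogeneous C S Y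
theorem2p3 zero k (x ∷ X) fin lX above T tree (level ∷ _ , _) C =
  -- A single level has no consecutive pairs, so any colour serves, and `C []` provides one.
  x ∷ [] , T , [-] , here refl ∷ [] , tt , tree , (λ _ m → m) , (level ∷ [] , tt) , C [] , tt
theorem2p3 (suc d) k X fin lX above T tree qs C
  with X | subst (λ n → Large n X) (trans (+-comm _ 1) (cong suc (*-comm 2 (suc d)))) lX
theorem2p3 (suc d) k _ fin lX above T tree ((σ , m , l) ∷ _ , br) C | x ∷ X | lX′
  with large-Solver d k (x ∷ X) x (≤-trans (s≤s (m≤m⊔n 4 k)) above) (≤-trans (s≤s (m≤n⊔m 4 k)) above)
         (≤-refl , FinSet⇒Ascending fin) lX′ (colours T tree C x X br σ m l)
... | c , y ∷ Y , lY , t with subtree T tree C c t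
... | ρ , _ , _ , s = y ∷ Y , nodes T tree C c s , finY , Good-⊆ t , lY ,
  nodes-tree T tree C c s , nodes-⊆T T tree C c s ,
  (nodes-levels T tree C c s , Consecutive-map proj₁ (y ∷ Y) steps) , c , Consecutive-map proj₂ (y ∷ Y) steps
  where
  finY : FinSet (y ∷ Y)
  finY = Ascending⇒FinSet (y ∷ Y) (Good-Ascending t (≤-refl , FinSet⇒Ascending fin))
  steps = nodes-steps T tree C c s finY
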